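{- Let $\mathcal{L}=(L,\prec_{\mathcal{L}})$ be a computable linear order, and let $C\subseteq\mathbb{N}$ be co-c.e. and cohesive. Then the finite condensation $c_F(\Pi_C\mathcal{L})$ is dense, i.e., for any two of its elements $I<J$ there is an element $K$ with $I<K<J$.
   Context: A set $C\subseteq\mathbb{N}$ is cohesive if it is infinite and for every c.e. set $W$, either $C\setminus W$ or $C\cap W$ is finite; co-c.e. means $\mathbb{N}\setminus C$ is c.e. Write $X\subseteq^* Y$ if $X\setminus Y$ is finite. For a computable linear order $\mathcal{L}=(L,\prec_{\mathcal{L}})$, the cohesive power $\Pi_C\mathcal{L}$ has as elements the classes $[\varphi]$ of partial computable $\varphi\colon\mathbb{N}\to L$ with $C\subseteq^*\mathrm{dom}(\varphi)$ under $\varphi=_C\psi$ iff $C\subseteq^*\{x:\varphi(x)\downarrow=\psi(x)\downarrow\}$, ordered by $[\varphi]\prec[\psi]$ iff $C\subseteq^*\{x:\varphi(x)\downarrow,\psi(x)\downarrow,\varphi(x)\prec_{\mathcal{L}}\psi(x)\}$. For a linear order $\mathcal{M}$ and element $x$, $c_F(x)$ is the set of $y$ such that the closed interval between $x$ and $y$ is finite; these sets partition $\mathcal{M}$ into intervals (blocks), and the finite condensation $c_F(\mathcal{M})$ is the set of blocks ordered by $I<J$ iff every element of $I$ is below every element of $J$. -}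

module Defs where

open import Data.Nat using (ℕ; zero; suc; _<_)
open import Data.Fin using (Fin)
open import Data.Vec using (Vec; []; _∷_; lookup)
open import Data.Bool using (Bool; true; false)
open import Data.List using (List)
open import Data.List.Relation.Unary.Any using (Any)
open import Data.Product using (Σ; ∃; ∃₂; _×_; _,_)
open import Data.Sum using (_⊎_)
open import Relation.Binary.PropositionalEquality using (_≡_)
open import Relation.Nullary using (¬_)

-- Partial recursive functions (Kleene), as a model of partial computable
-- functions.  PR n = codes of n-ary partial recursive functions.

data PR : ℕ → Set where
  zer  : ∀ {n} → PR n
  sucᶠ : PR 1
  proj : ∀ {n} → Fin n → PR n
  comp : ∀ {m n} → PR m → Vec (PR n) m → PR n
  prec : ∀ {n} → PR n → PR (suc (suc n)) → PR (suc n)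
  mu   : ∀ {n} → PR (suc n) → PR n

data _[_]⇓_ : ∀ {n} → PR n → Vec ℕ n → ℕ → Set
data _[_]⇓*_ : ∀ {m n} → Vec (PR n) m → Vec ℕ n → Vec ℕ m → Set
data MinSearch : ∀ {n} → PR (suc n) → Vec ℕ n → ℕ → ℕ → Set

data _[_]⇓_ where
  zer⇓  : ∀ {n} {xs : Vec ℕ n} → zer [ xs ]⇓ 0
  suc⇓  : ∀ {x} → sucᶠ [ x ∷ [] ]⇓ suc x
  proj⇓ : ∀ {n} {i : Fin n} {xs} → proj i [ xs ]⇓ lookup xs i
  comp⇓ : ∀ {m n} {f : PR m} {gs : Vec (PR n) m} {xs ys y} →
          gs [ xs ]⇓* ys → f [ ys ]⇓ y → comp f gs [ xs ]⇓ y
  prec0⇓ : ∀ {n} {g : PR n} {h xs y} →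
           g [ xs ]⇓ y → prec g h [ 0 ∷ xs ]⇓ y
  precS⇓ : ∀ {n} {g : PR n} {h xs k r y} →
           prec g h [ k ∷ xs ]⇓ r → h [ k ∷ r ∷ xs ]⇓ y →
           prec g h [ suc k ∷ xs ]⇓ y
  mu⇓   : ∀ {n} {f : PR (suc n)} {xs y} →
          MinSearch f xs 0 y → mu f [ xs ]⇓ y

data _[_]⇓*_ where
  []⇓  : ∀ {n} {xs : Vec ℕ n} → [] [ xs ]⇓* []
  ∷⇓   : ∀ {m n} {g : PR n} {gs : Vec (PR n) m} {xs y ys} →
         g [ xs ]⇓ y → gs [ xs ]⇓* ys → (g ∷ gs) [ xs ]⇓* (y ∷ ys)

data MinSearch where
  here  : ∀ {n} {f : PR (suc n)} {xs k} →
          f [ k ∷ xs ]⇓ 0 → MinSearch f xs k k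
  there : ∀ {n} {f : PR (suc n)} {xs k v y} →
          f [ k ∷ xs ]⇓ suc v → MinSearch f xs (suc k) y → MinSearch f xs k y

_⟨_⟩⇓_ : PR 1 → ℕ → ℕ → Set
e ⟨ x ⟩⇓ y = e [ x ∷ [] ]⇓ y

Halts : PR 1 → ℕ → Set
Halts e x = ∃ λ y → e ⟨ x ⟩⇓ y

Finite : (ℕ → Set) → Set
Finite S = ∃ λ N → ∀ x → S x → x < N

Infinite : (ℕ → Set) → Set
Infinite S = ¬ Finite S

_⊆*_ : (ℕ → Set) → (ℕ → Set) → Set
A ⊆* B = Finite (λ x → A x × ¬ B x)

CE : (ℕ → Set) → Set
CE W = Σ (PR 1) λ e → ∀ x → (W x → Halts e x) × (Halts e x → W x)

CoCE : (ℕ → Set) → Set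
CoCE C = CE (λ x → ¬ C x)

Cohesive : (ℕ → Set) → Set
Cohesive C = Infinite C ×
  (∀ (e : PR 1) →   -- W = W_e = dom(e), ranging over all c.e. sets
     Finite (λ x → C x × ¬ Halts e x) ⊎ Finite (λ x → C x × Halts e x))

b2n : Bool → ℕ
b2n true  = 1
b2n false = 0

record CompLinOrder : Set where
  field
    inL  : ℕ → Bool
    lt   : ℕ → ℕ → Bool
    inL-computable : Σ (PR 1) λ e → ∀ x → e [ x ∷ [] ]⇓ b2n (inL x)
    lt-computable  : Σ (PR 2) λ e → ∀ x y → e [ x ∷ y ∷ [] ]⇓ b2n (lt x y)
    irrefl : ∀ x → inL x ≡ true → lt x x ≡ false
    trans  : ∀ x y z → inL x ≡ true → inL y ≡ true → inL z ≡ true →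
             lt x y ≡ true → lt y z ≡ true → lt x z ≡ true
    trich  : ∀ x y → inL x ≡ true → inL y ≡ true →
             lt x y ≡ true ⊎ (x ≡ y ⊎ lt y x ≡ true)

-- Cohesive power Π_C 𝓛 (as a setoid of representatives)

module CohesivePower (𝓛 : CompLinOrder) (C : ℕ → Set) where
  open CompLinOrder 𝓛

  record Elt : Set where
    constructor elt
    field
      fn     : PR 1
      domC   : C ⊆* Halts fn
      range  : ∀ x y → fn ⟨ x ⟩⇓ y → inL y ≡ true
  open Elt public

  _=C_ : Elt → Elt → Set
  φ =C ψ = C ⊆* (λ x → ∃ λ y → fn φ ⟨ x ⟩⇓ y × fn ψ ⟨ x ⟩⇓ y)

  _≺C_ : Elt → Elt → Set
  φ ≺C ψ = C ⊆* (λ x → ∃₂ λ a b → fn φ ⟨ x ⟩⇓ a × fn ψ ⟨ x ⟩⇓ b × lt a b ≡ true)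

  _⪯C_ : Elt → Elt → Set
  φ ⪯C ψ = φ ≺C ψ ⊎ φ =C ψ

  InInterval : Elt → Elt → Elt → Set
  InInterval a b z = (a ⪯C z × z ⪯C b) ⊎ (b ⪯C z × z ⪯C a)

  -- finite subset of the setoid: covered, up to =C, by a finite list
  FiniteInterval : Elt → Elt → Set
  FiniteInterval a b = ∃ λ (l : List Elt) → ∀ z → InInterval a b z → Any (z =C_) l

  InBlock : Elt → Elt → Set
  InBlock x y = FiniteInterval x y

  BlockLt : Elt → Elt → Set
  BlockLt a b = ∀ x y → InBlock a x → InBlock b y → x ≺C y

  CondensationDense : Set
  CondensationDense = ∀ a b → BlockLt a b → ∃ λ c → BlockLt a c × BlockLt c b

{-# OPTIONS --safe #-}
module Submission where

-- By cohesiveness every c.e. set either contains or misses almost all of C.  If only boundedly many elements of 𝓛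
-- lie strictly between a(n) and b(n) for almost all n ∈ C, then the functions picking the i-th of them, ordered as
-- natural numbers, show that [a, b] is finite; so blocks are distinct exactly when the number of elements between
-- a(n) and b(n) tends to infinity along C.  To split such an interval, let n wait for a stage s ≥ n at which every
-- rival m < n has either left C or has fewer elements of (a(m), b(m)) discovered than n has.  If almost all n ∈ C
-- waited forever, the least n ∈ C with sufficiently many discovered elements would be a contradiction; and since each
-- fixed m ∈ C is a rival of all later n, the number of elements discovered by the stage of n tends to infinity
-- along C.  A median of these elements is therefore infinitely far from both a and b.

open import Defs
open import Data.Bool using (true; false)
open import Data.Empty using (⊥; ⊥-elim)
open import Data.Fin using (Fin; zero; suc; toℕ)
import Data.Fin.Properties as Fin
open import Data.List using (List; []; _∷_; _++_; length)
import Data.List as List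
open import Data.List.Relation.Unary.Any using (Any; here; there; index)
open import Data.List.Relation.Unary.Any.Properties using (++⁺ˡ; ++⁺ʳ; lookup-index)
open import Data.Nat using (ℕ; zero; suc; _+_; _*_; _∸_; _⊓_; _⊔_; _≤_; _<_; z≤n; s≤s; z<s; s≤s⁻¹)
open import Data.Nat.Induction using (<-rec)
open import Data.Nat.Properties
open import Algebra.Properties.CommutativeSemigroup +-commutativeSemigroup using (interchange)
open import Data.Product using (∃; ∃₂; _×_; _,_; proj₁; proj₂)
open import Data.Sum using (_⊎_; inj₁; inj₂; [_,_]′)
open import Data.Vec using (Vec; []; _∷_; head; tail; lookup; map; tabulate)
open import Function using (_∘_; case_of_)
open import Relation.Binary.Definitions using (tri<; tri≈; tri>)
open import Relation.Binary.PropositionalEquality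
  using (_≡_; _≢_; refl; sym; trans; cong; cong₂; subst; subst₂; module ≡-Reasoning)
open import Relation.Nullary using (¬_; yes; no; does; contradiction)
open import Relation.Nullary.Decidable using (dec-true; dec-false; decidable-stable; ¬¬-excluded-middle)
open import Relation.Nullary.Negation using (¬¬-map)

private
  variable
    m n : ℕ

-- Total computable functions

-- A code bundled with the function it computes, so that tests can be reasoned about as ordinary
-- functions on natural numbers.
record Total (n : ℕ) : Set where
  field
    code     : PR n
    fun      : Vec ℕ n → ℕ
    computes : ∀ xs → code [ xs ]⇓ fun xs
open Total

recℕ : {A : Set} → A → (ℕ → A → A) → ℕ → A
recℕ z f zero    = z
recℕ z f (suc k) = f k (recℕ z f k)

caseℕ : {A : Set} → ℕ → A → (ℕ → A) → A
caseℕ zero    z f = z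
caseℕ (suc p) z f = f p

sumBelow : ℕ → (ℕ → ℕ) → ℕ
sumBelow zero    f = 0
sumBelow (suc k) f = sumBelow k f + f k

zeroT : Total n
zeroT .code       = zer
zeroT .fun _      = 0
zeroT .computes _ = zer⇓

sucT : Total n → Total n
sucT F .code        = comp sucᶠ (code F ∷ [])
sucT F .fun xs      = suc (fun F xs)
sucT F .computes xs = comp⇓ (∷⇓ (computes F xs) []⇓) suc⇓

projT : Fin n → Total n
projT i .code       = proj i
projT i .fun xs     = lookup xs i
projT i .computes _ = proj⇓

compT : Total m → Vec (Total n) m → Total n
compT F Gs .code        = comp (code F) (map code Gs)
compT F Gs .fun xs      = fun F (map (λ G → fun G xs) Gs)
compT F Gs .computes xs = comp⇓ (go Gs) (computes F _)
  where
  go : ∀ {m} (Gs : Vec (Total _) m) → map code Gs [ xs ]⇓* map (λ G → fun G xs) Gs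
  go []       = []⇓
  go (G ∷ Gs) = ∷⇓ (computes G xs) (go Gs)

precT : Total n → Total (suc (suc n)) → Total (suc n)
precT G H .code   = prec (code G) (code H)
precT G H .fun xs = recℕ (fun G (tail xs)) (λ k r → fun H (k ∷ r ∷ tail xs)) (head xs)
precT G H .computes (k ∷ xs) = go k
  where
  go : ∀ k → prec (code G) (code H) [ k ∷ xs ]⇓ precT G H .fun (k ∷ xs)
  go zero    = prec0⇓ (computes G xs)
  go (suc k) = precS⇓ (go k) (computes H _)

-- Lets `fun` be a library operation, with its known laws, while the code stays the one built by
-- recursion.
retarget : (F : Total n) (f : Vec ℕ n → ℕ) → (∀ xs → fun F xs ≡ f xs) → Total n
retarget F f eq .code        = code F
retarget F f eq .fun         = f
retarget F f eq .computes xs = subst (code F [ xs ]⇓_) (eq xs) (computes F xs)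

projections⇓ : (ρ : Fin m → Fin n) (xs : Vec ℕ n) (ys : Vec ℕ m) →
               (∀ i → lookup xs (ρ i) ≡ lookup ys i) →
               tabulate (λ i → proj (ρ i)) [ xs ]⇓* ys
projections⇓ ρ xs []       eq = []⇓
projections⇓ ρ xs (y ∷ ys) eq =
  ∷⇓ (subst (proj (ρ zero) [ xs ]⇓_) (eq zero) proj⇓)
     (projections⇓ (λ i → ρ (suc i)) xs ys (λ i → eq (suc i)))

renameT : (ρ : Fin m → Fin n) (r : Vec ℕ n → Vec ℕ m) →
          (∀ xs i → lookup xs (ρ i) ≡ lookup (r xs) i) → Total m → Total n
renameT ρ r eq F .code        = comp (code F) (tabulate (λ i → proj (ρ i)))
renameT ρ r eq F .fun xs      = fun F (r xs)
renameT ρ r eq F .computes xs = comp⇓ (projections⇓ ρ xs (r xs) (eq xs)) (computes F _)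

weakenT : Total n → Total (suc n)
weakenT = renameT suc tail (λ { (_ ∷ _) _ → refl })

dropSecondT : Total (suc n) → Total (suc (suc n))
dropSecondT = renameT (λ { zero → zero ; (suc i) → suc (suc i) }) (λ v → head v ∷ tail (tail v))
                      (λ { (_ ∷ _ ∷ _) zero → refl ; (_ ∷ _ ∷ _) (suc _) → refl })

-- Case distinction is primitive recursion whose step discards the recursive value.
caseT : Total n → Total n → Total (suc n) → Total n
caseT F G H .code   = comp (prec (code G) (code (dropSecondT H))) (code F ∷ tabulate proj)
caseT F G H .fun xs = caseℕ (fun F xs) (fun G xs) (λ p → fun H (p ∷ xs))
caseT F G H .computes xs =
  comp⇓ (∷⇓ (computes F xs) (projections⇓ (λ i → i) xs xs (λ _ → refl))) (go (fun F xs))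
  where
  R : Total _
  R = precT G (dropSecondT H)
  go : ∀ k → code R [ k ∷ xs ]⇓ caseℕ k (fun G xs) (λ p → fun H (p ∷ xs))
  go zero    = computes R (0 ∷ xs)
  go (suc p) = computes R (suc p ∷ xs)

predT : Total n → Total n
predT F = caseT F zeroT (projT zero)

addT mulT monusT minT : Total n → Total n → Total n
addT F G = retarget (compT plus (F ∷ G ∷ [])) (λ xs → fun F xs + fun G xs)
                    (λ xs → go (fun F xs))
  where
  plus : Total 2
  plus = precT (projT zero) (sucT (projT (suc zero)))
  go : ∀ {y} k → recℕ y (λ _ r → suc r) k ≡ k + y
  go zero    = refl
  go (suc k) = cong suc (go k)
mulT F G = retarget (compT times (F ∷ G ∷ [])) (λ xs → fun F xs * fun G xs)
                    (λ xs → go (fun F xs))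
  where
  times : Total 2
  times = precT zeroT (addT (projT (suc (suc zero))) (projT (suc zero)))
  go : ∀ {y} k → recℕ 0 (λ _ r → y + r) k ≡ k * y
  go zero    = refl
  go {y} (suc k) = cong (y +_) (go k)
monusT F G = retarget (compT minus (G ∷ F ∷ [])) (λ xs → fun F xs ∸ fun G xs)
                      (λ xs → go (fun F xs) (fun G xs))
  where
  minus : Total 2
  minus = precT (projT zero) (predT (projT (suc zero)))
  step∸ : ∀ x k → caseℕ (x ∸ k) 0 (λ p → p) ≡ x ∸ suc k
  step∸ zero    zero    = refl
  step∸ zero    (suc k) = refl
  step∸ (suc x) zero    = refl
  step∸ (suc x) (suc k) = step∸ x k
  go : ∀ x k → recℕ x (λ _ r → caseℕ r 0 (λ p → p)) k ≡ x ∸ k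
  go x zero    = refl
  go x (suc k) = trans (cong (λ r → caseℕ r 0 (λ p → p)) (go x k)) (step∸ x k)
minT F G = retarget (monusT F (monusT F G)) (λ xs → fun F xs ⊓ fun G xs)
                    (λ xs → go (fun F xs) (fun G xs))
  where
  go : ∀ x y → x ∸ (x ∸ y) ≡ x ⊓ y
  go x y with ≤-total x y
  ... | inj₁ x≤y = trans (cong (x ∸_) (m≤n⇒m∸n≡0 x≤y)) (sym (m≤n⇒m⊓n≡m x≤y))
  ... | inj₂ y≤x = trans (m∸[m∸n]≡n y≤x) (sym (m≥n⇒m⊓n≡n y≤x))

numeralT : ℕ → Total n
numeralT k = retarget (iterate k) (λ _ → k) (λ _ → go k)
  where
  iterate : ∀ {n} → ℕ → Total n
  iterate zero    = zeroT
  iterate (suc k) = sucT (iterate k)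
  go : ∀ k {n} {xs : Vec ℕ n} → fun (iterate k) xs ≡ k
  go zero    = refl
  go (suc k) = cong suc (go k)

sumT : Total (suc n) → Total (suc n)
sumT F = retarget
  (precT zeroT (addT (projT (suc zero))
    (dropSecondT F)))
  (λ xs → sumBelow (head xs) (λ i → fun F (i ∷ tail xs)))
  (λ xs → go (tail xs) (head xs))
  where
  go : ∀ xs k → recℕ 0 (λ i r → r + fun F (i ∷ xs)) k ≡ sumBelow k (λ i → fun F (i ∷ xs))
  go xs zero    = refl
  go xs (suc k) = cong (_+ fun F (k ∷ xs)) (go xs k)

-- Stagewise evaluation

-- Serves as a conjunction: the product is positive exactly when every factor is.
productT : Vec (Total n) m → Total n
productT []       = sucT zeroT
productT (F ∷ Fs) = mulT F (productT Fs)

-- step e maps s ∷ xs to suc y if the computation of e on xs is seen to return y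
-- within s stages, and to 0 otherwise.
step  : PR n → Total (suc n)
steps : Vec (PR n) m → Vec (Total (suc n)) m
stepRec : PR n → PR (suc (suc n)) → Total (suc (suc n))
stepSearch : PR (suc n) → Total (suc (suc n))

step zer         = sucT zeroT
step sucᶠ        = sucT (sucT (projT (suc zero)))
step (proj i)    = sucT (projT (suc i))
step (comp f gs) = caseT (productT (steps gs)) zeroT
                         (weakenT (compT (step f) (projT zero ∷ map predT (steps gs))))
step (prec g h)  = renameT (λ { zero → suc zero ; (suc zero) → zero ; (suc (suc i)) → suc (suc i) })
                           (λ v → head (tail v) ∷ head v ∷ tail (tail v))
                           (λ { (_ ∷ _ ∷ _) zero → refl ; (_ ∷ _ ∷ _) (suc zero) → refl
                              ; (_ ∷ _ ∷ _) (suc (suc _)) → refl })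
                           (stepRec g h)
-- The stage is also the bound of the search, hence its duplication; `predT` turns `suc (suc y)`
-- into `suc y` and the undecided value 1 into 0.
step (mu f)      = predT (renameT (λ { zero → zero ; (suc i) → i }) (λ v → head v ∷ v)
                                  (λ { (_ ∷ _) zero → refl ; (_ ∷ _) (suc _) → refl })
                                  (stepSearch f))

steps []       = []
steps (g ∷ gs) = step g ∷ steps gs

stepRec g h =
  precT (step g)
        (caseT (projT (suc zero)) zeroT
          -- The context is p ∷ k ∷ r ∷ s ∷ xs, where r = `suc p` encodes the recursive value;
          -- `step h` receives s ∷ k ∷ p ∷ xs.
          (renameT (λ { zero → suc (suc (suc zero)) ; (suc zero) → suc zero ; (suc (suc zero)) → zero
                      ; (suc (suc (suc i))) → suc (suc (suc (suc i))) })
                   (λ v → head (tail (tail (tail v))) ∷ head (tail v) ∷ head v ∷ tail (tail (tail (tail v))))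
                   (λ { (_ ∷ _ ∷ _ ∷ _ ∷ _) zero → refl ; (_ ∷ _ ∷ _ ∷ _ ∷ _) (suc zero) → refl
                      ; (_ ∷ _ ∷ _ ∷ _ ∷ _) (suc (suc zero)) → refl
                      ; (_ ∷ _ ∷ _ ∷ _ ∷ _) (suc (suc (suc _))) → refl })
                   (step h)))

-- On j ∷ s ∷ xs: 0 while the s-stage values of f at 0, …, j - 1 are positive,
-- suc (suc y) once the first zero y is met, and 1 once an undecided value is met.
stepSearch f =
  precT zeroT
        (caseT (projT (suc zero))
          (caseT (renameT (λ { zero → suc (suc zero) ; (suc zero) → zero
                             ; (suc (suc i)) → suc (suc (suc i)) })
                          (λ v → head (tail (tail v)) ∷ head v ∷ tail (tail (tail v)))
                          (λ { (_ ∷ _ ∷ _ ∷ _) zero → refl ; (_ ∷ _ ∷ _ ∷ _) (suc zero) → refl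
                             ; (_ ∷ _ ∷ _ ∷ _) (suc (suc _)) → refl })
                          (step f))
                 (sucT zeroT)
                 (caseT (projT zero) (sucT (sucT (projT (suc zero)))) zeroT))
          (sucT (projT zero)))

case-suc : ∀ x (f : ℕ → ℕ) {y} → caseℕ x 0 f ≡ suc y → ∃ λ p → x ≡ suc p × f p ≡ suc y
case-suc (suc p) f eq = p , refl , eq

*≡suc : ∀ x y {p} → x * y ≡ suc p → ∃₂ λ q r → x ≡ suc q × y ≡ suc r
*≡suc zero    y       ()
*≡suc (suc q) zero    eq = contradiction (trans (sym (*-zeroʳ q)) eq) λ ()
*≡suc (suc q) (suc r) eq = q , r , refl , refl

step-sound : (e : PR n) (s : ℕ) (xs : Vec ℕ n) {y : ℕ} → fun (step e) (s ∷ xs) ≡ suc y → e [ xs ]⇓ y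
steps-sound : (gs : Vec (PR n) m) (s : ℕ) (xs : Vec ℕ n) {p : ℕ} →
              fun (productT (steps gs)) (s ∷ xs) ≡ suc p →
              gs [ xs ]⇓* map (λ G → fun G (s ∷ xs)) (map predT (steps gs))
stepRec-sound : (g : PR n) (h : PR (suc (suc n))) (k s : ℕ) (xs : Vec ℕ n) {y : ℕ} →
                fun (stepRec g h) (k ∷ s ∷ xs) ≡ suc y → prec g h [ k ∷ xs ]⇓ y
-- The value 0 certifies that `f` is positive at all indices below j, so a search from j extends
-- backwards to one from 0.
stepSearch-0 : (f : PR (suc n)) (j s : ℕ) (xs : Vec ℕ n) → fun (stepSearch f) (j ∷ s ∷ xs) ≡ 0 →
               ∀ {y} → MinSearch f xs j y → MinSearch f xs 0 y
-- A value above 1 is copied upwards from the index just after the zero; the induction descends to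
-- that index.
stepSearch-sound : (f : PR (suc n)) (j s : ℕ) (xs : Vec ℕ n) {y : ℕ} →
                   fun (stepSearch f) (j ∷ s ∷ xs) ≡ suc (suc y) → MinSearch f xs 0 y

step-sound zer         s xs       refl = zer⇓
step-sound sucᶠ        s (x ∷ []) refl = suc⇓
step-sound (proj i)    s xs       refl = proj⇓
step-sound (comp f gs) s xs       eq
  with _ , eq₁ , eq₂ ← case-suc (fun (productT (steps gs)) (s ∷ xs)) _ eq =
  comp⇓ (steps-sound gs s xs eq₁) (step-sound f s _ eq₂)
step-sound (prec g h)  s (k ∷ xs) eq = stepRec-sound g h k s xs eq
step-sound (mu f)      s xs       eq
  with _ , eq₁ , refl ← case-suc (fun (stepSearch f) (s ∷ s ∷ xs)) _ eq =
  mu⇓ (stepSearch-sound f s s xs eq₁)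

steps-sound []       s xs eq = []⇓
steps-sound (g ∷ gs) s xs eq
  with _ , _ , eq₁ , eq₂ ← *≡suc (fun (step g) (s ∷ xs)) (fun (productT (steps gs)) (s ∷ xs)) eq =
  ∷⇓ (subst (λ v → g [ xs ]⇓ caseℕ v 0 (λ p → p)) (sym eq₁) (step-sound g s xs eq₁))
     (steps-sound gs s xs eq₂)

stepRec-sound g h zero    s xs eq = prec0⇓ (step-sound g s xs eq)
stepRec-sound g h (suc k) s xs eq
  with _ , eq₁ , eq₂ ← case-suc (fun (stepRec g h) (k ∷ s ∷ xs)) _ eq =
  precS⇓ (stepRec-sound g h k s xs eq₁) (step-sound h s _ eq₂)

stepSearch-0 f zero    s xs eq found = found
stepSearch-0 f (suc j) s xs eq found
  with fun (stepSearch f) (j ∷ s ∷ xs) in eq₁ | eq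
... | zero | eq′ with fun (step f) (s ∷ j ∷ xs) in eq₂ | eq′
...   | suc (suc v) | _ =
        stepSearch-0 f j s xs eq₁ (there (step-sound f s (j ∷ xs) eq₂) found)

stepSearch-sound f (suc j) s xs eq
  with fun (stepSearch f) (j ∷ s ∷ xs) in eq₁ | eq
... | suc p | eq′ = stepSearch-sound f j s xs (trans eq₁ eq′)
... | zero  | eq′ with fun (step f) (s ∷ j ∷ xs) in eq₂ | eq′
...   | suc zero | refl = stepSearch-0 f j s xs eq₁ (here (step-sound f s (j ∷ xs) eq₂))

-- Completeness of stagewise evaluation, and determinism

Eventually : (ℕ → Set) → Set
Eventually P = ∃ λ S → ∀ s → S ≤ s → P s

eventually-map : {P Q : ℕ → Set} → (∀ s → P s → Q s) → Eventually P → Eventually Q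
eventually-map f (S , p) = S , λ s S≤s → f s (p s S≤s)

eventually-∧ : {P Q : ℕ → Set} → Eventually P → Eventually Q → Eventually (λ s → P s × Q s)
eventually-∧ (S , p) (T , q) =
  S ⊔ T , λ s S⊔T≤s → p s (m⊔n≤o⇒m≤o S T S⊔T≤s) , q s (m⊔n≤o⇒n≤o S T S⊔T≤s)

-- Claiming all late stages rather than a single one lets the stages of subcomputations be merged by
-- a maximum.
step-complete : {e : PR n} {xs : Vec ℕ n} {y : ℕ} → e [ xs ]⇓ y →
                Eventually (λ s → fun (step e) (s ∷ xs) ≡ suc y)
steps-complete : {gs : Vec (PR n) m} {xs : Vec ℕ n} {ys : Vec ℕ m} → gs [ xs ]⇓* ys →
                 Eventually (λ s → (∃ λ p → fun (productT (steps gs)) (s ∷ xs) ≡ suc p) ×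
                                   map (λ G → fun G (s ∷ xs)) (map predT (steps gs)) ≡ ys)
stepRec-complete : {g : PR n} {h : PR (suc (suc n))} {k : ℕ} {xs : Vec ℕ n} {y : ℕ} →
                   prec g h [ k ∷ xs ]⇓ y →
                   Eventually (λ s → fun (stepRec g h) (k ∷ s ∷ xs) ≡ suc y)
-- The premise, that nothing before j has ended the search at stage s, is the invariant of the
-- induction; at j = 0 it holds by computation.
stepSearch-complete : {f : PR (suc n)} {xs : Vec ℕ n} {j y : ℕ} → MinSearch f xs j y →
  Eventually (λ s → fun (stepSearch f) (j ∷ s ∷ xs) ≡ 0 →
                    fun (stepSearch f) (suc y ∷ s ∷ xs) ≡ suc (suc y))
-- A nonzero verdict is final, so the answer at index `suc y` is still the answer at the search
-- bound.
stepSearch-stable : (f : PR (suc n)) (xs : Vec ℕ n) (s j d : ℕ) {p : ℕ} →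
                    fun (stepSearch f) (j ∷ s ∷ xs) ≡ suc p →
                    fun (stepSearch f) (d + j ∷ s ∷ xs) ≡ suc p
stepSearch-stable f xs s j zero    eq = eq
stepSearch-stable f xs s j (suc d) eq
  rewrite stepSearch-stable f xs s j d eq = refl

step-complete zer⇓  = 0 , λ _ _ → refl
step-complete suc⇓  = 0 , λ _ _ → refl
step-complete proj⇓ = 0 , λ _ _ → refl
step-complete {e = comp f gs} {xs} (comp⇓ gs⇓ f⇓) =
  eventually-map (λ s → λ { (((p , eq₁) , eq₂) , eq₃) → go s p eq₁ eq₂ eq₃ })
                 (eventually-∧ (steps-complete gs⇓) (step-complete f⇓))
  where
  go : ∀ s p {ys y} → fun (productT (steps gs)) (s ∷ xs) ≡ suc p →
       map (λ G → fun G (s ∷ xs)) (map predT (steps gs)) ≡ ys →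
       fun (step f) (s ∷ ys) ≡ suc y → fun (step (comp f gs)) (s ∷ xs) ≡ suc y
  go s p eq₁ refl eq₃ rewrite eq₁ = eq₃
step-complete {e = prec g h} d@(prec0⇓ _)   = stepRec-complete d
step-complete {e = prec g h} d@(precS⇓ _ _) = stepRec-complete d
step-complete {e = mu f} {xs} {y} (mu⇓ found) with S , p ← stepSearch-complete found =
  -- The stage must exceed y as well, because it bounds the search.
  S ⊔ suc y , λ s le →
    let y<s = m⊔n≤o⇒n≤o S (suc y) le in
    cong (λ v → caseℕ v 0 (λ p → p))
         (subst (λ j → fun (stepSearch f) (j ∷ s ∷ xs) ≡ suc (suc y)) (m∸n+n≡m y<s)
                (stepSearch-stable f xs s (suc y) (s ∸ suc y) (p s (m⊔n≤o⇒m≤o S (suc y) le) refl)))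

steps-complete []⇓ = 0 , λ _ _ → (0 , refl) , refl
steps-complete {gs = g ∷ gs} (∷⇓ g⇓ gs⇓) =
  eventually-map (λ s → λ { (eq₁ , (p , eq₂) , eq₃) →
                   (_ , cong₂ _*_ eq₁ eq₂) , cong₂ _∷_ (cong (λ v → caseℕ v 0 (λ q → q)) eq₁) eq₃ })
                 (eventually-∧ (step-complete g⇓) (steps-complete gs⇓))

stepRec-complete (prec0⇓ g⇓) = step-complete g⇓
stepRec-complete {g = g} {h} {suc k} {xs} (precS⇓ r⇓ h⇓) =
  eventually-map (λ s → λ { (eq₁ , eq₂) → go s eq₁ eq₂ })
                 (eventually-∧ (stepRec-complete r⇓) (step-complete h⇓))
  where
  go : ∀ s {r y} → fun (stepRec g h) (k ∷ s ∷ xs) ≡ suc r →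
       fun (step h) (s ∷ k ∷ r ∷ xs) ≡ suc y → fun (stepRec g h) (suc k ∷ s ∷ xs) ≡ suc y
  go s eq₁ eq₂ rewrite eq₁ = eq₂

stepSearch-complete {f = f} {xs} {j} (here f⇓) =
  eventually-map (λ s eq₁ eq₀ → go s eq₀ eq₁) (step-complete f⇓)
  where
  go : ∀ s → fun (stepSearch f) (j ∷ s ∷ xs) ≡ 0 → fun (step f) (s ∷ j ∷ xs) ≡ 1 →
       fun (stepSearch f) (suc j ∷ s ∷ xs) ≡ suc (suc j)
  go s eq₀ eq₁ rewrite eq₀ | eq₁ = refl
stepSearch-complete {f = f} {xs} {j} (there f⇓ found) =
  eventually-map (λ s → λ { (eq₁ , rest) eq₀ → rest (go s eq₀ eq₁) })
                 (eventually-∧ (step-complete f⇓) (stepSearch-complete found))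
  where
  go : ∀ s {v} → fun (stepSearch f) (j ∷ s ∷ xs) ≡ 0 → fun (step f) (s ∷ j ∷ xs) ≡ suc (suc v) →
       fun (stepSearch f) (suc j ∷ s ∷ xs) ≡ 0
  go s eq₀ eq₁ rewrite eq₀ | eq₁ = refl

-- Both results appear at a common late stage, where `step` has only one value.
⇓-deterministic : {e : PR n} {xs : Vec ℕ n} {y z : ℕ} → e [ xs ]⇓ y → e [ xs ]⇓ z → y ≡ z
⇓-deterministic d d′ with S , p ← eventually-∧ (step-complete d) (step-complete d′)
  with eq , eq′ ← p S ≤-refl = suc-injective (trans (sym eq) eq′)

⇓*-deterministic : {gs : Vec (PR n) m} {xs : Vec ℕ n} {ys zs : Vec ℕ m} →
                   gs [ xs ]⇓* ys → gs [ xs ]⇓* zs → ys ≡ zs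
⇓*-deterministic []⇓        []⇓          = refl
⇓*-deterministic (∷⇓ d ds) (∷⇓ d′ ds′) = cong₂ _∷_ (⇓-deterministic d d′) (⇓*-deterministic ds ds′)

-- Unbounded search for a zero of a total function

opaque
  search : Total (suc m) → Vec (PR n) m → PR n
  search F gs = comp (mu (code F)) gs

  search-sound : (F : Total (suc m)) {gs : Vec (PR n) m} {xs : Vec ℕ n} {y : ℕ} → search F gs [ xs ]⇓ y →
                 ∃ λ ys → gs [ xs ]⇓* ys × fun F (y ∷ ys) ≡ 0
  search-sound F (comp⇓ {ys = ys} gs⇓ (mu⇓ found)) = ys , gs⇓ , go found
    where
    go : ∀ {k y} → MinSearch (code F) ys k y → fun F (y ∷ ys) ≡ 0
    go (here d)    = ⇓-deterministic (computes F _) d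
    go (there _ r) = go r

  -- The search may stop at a zero below w, so only the existence of a value is claimed.
  search-complete : (F : Total (suc m)) {gs : Vec (PR n) m} {xs : Vec ℕ n} {ys : Vec ℕ m} →
                    gs [ xs ]⇓* ys → ∀ w → fun F (w ∷ ys) ≡ 0 → ∃ λ y → search F gs [ xs ]⇓ y
  search-complete F {ys = ys} gs⇓ w eq =
    let y , found = go w 0 (+-identityʳ w) in y , comp⇓ gs⇓ (mu⇓ found)
    where
    go : ∀ d k → d + k ≡ w → ∃ (MinSearch (code F) ys k)
    go zero    k refl = k , here (subst (code F [ k ∷ ys ]⇓_) eq (computes F _))
    go (suc d) k d+k≡w with fun F (k ∷ ys) in eq₁
    ... | zero  = k , here (subst (code F [ k ∷ ys ]⇓_) eq₁ (computes F _))
    ... | suc v with y , found ← go d (suc k) (trans (+-suc d k) d+k≡w) =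
      y , there (subst (code F [ k ∷ ys ]⇓_) eq₁ (computes F _)) found

search-sound₁ : (F : Total 2) {g : PR n} {xs : Vec ℕ n} {y : ℕ} → search F (g ∷ []) [ xs ]⇓ y →
                ∃ λ u → g [ xs ]⇓ u × fun F (y ∷ u ∷ []) ≡ 0
search-sound₁ F d with search-sound F d
... | u ∷ [] , ∷⇓ g⇓ []⇓ , eq = u , g⇓ , eq

search-sound₂ : (F : Total 3) {g h : PR n} {xs : Vec ℕ n} {y : ℕ} → search F (g ∷ h ∷ []) [ xs ]⇓ y →
                ∃₂ λ u v → g [ xs ]⇓ u × h [ xs ]⇓ v × fun F (y ∷ u ∷ v ∷ []) ≡ 0
search-sound₂ F d with search-sound F d
... | u ∷ v ∷ [] , ∷⇓ g⇓ (∷⇓ h⇓ []⇓) , eq = u , v , g⇓ , h⇓ , eq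

search-sound₃ : (F : Total 4) {g h k : PR n} {xs : Vec ℕ n} {y : ℕ} → search F (g ∷ h ∷ k ∷ []) [ xs ]⇓ y →
                ∃₂ λ u v → ∃ λ w → g [ xs ]⇓ u × h [ xs ]⇓ v × k [ xs ]⇓ w × fun F (y ∷ u ∷ v ∷ w ∷ []) ≡ 0
search-sound₃ F d with search-sound F d
... | u ∷ v ∷ w ∷ [] , ∷⇓ g⇓ (∷⇓ h⇓ (∷⇓ k⇓ []⇓)) , eq = u , v , w , g⇓ , h⇓ , k⇓ , eq

-- Finite sums, indicators and halving

sumBelow-mono : (f : ℕ → ℕ) {k l : ℕ} → k ≤ l → sumBelow k f ≤ sumBelow l f
sumBelow-mono f {k} {zero}  z≤n = z≤n
sumBelow-mono f {k} {suc l} k≤1+l with m≤n⇒m<n∨m≡n k≤1+l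
... | inj₁ (s≤s k≤l) = ≤-trans (sumBelow-mono f k≤l) (m≤m+n _ _)
... | inj₂ refl      = ≤-refl

sumBelow-+ : (f g : ℕ → ℕ) (k : ℕ) → sumBelow k (λ i → f i + g i) ≡ sumBelow k f + sumBelow k g
sumBelow-+ f g zero    = refl
sumBelow-+ f g (suc k) rewrite sumBelow-+ f g k = interchange (sumBelow k f) _ (f k) (g k)

sumBelow-cong : {f g : ℕ → ℕ} → (∀ i → f i ≡ g i) → (k : ℕ) → sumBelow k f ≡ sumBelow k g
sumBelow-cong eq zero    = refl
sumBelow-cong eq (suc k) = cong₂ _+_ (sumBelow-cong eq k) (eq k)

sumBelow≡0⇒ : (f : ℕ → ℕ) (k : ℕ) → sumBelow k f ≡ 0 → ∀ {i} → i < k → f i ≡ 0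
sumBelow≡0⇒ f (suc k) eq i<1+k with m≤n⇒m<n∨m≡n (s≤s⁻¹ i<1+k)
... | inj₁ i<k  = sumBelow≡0⇒ f k (m+n≡0⇒m≡0 _ eq) i<k
... | inj₂ refl = m+n≡0⇒n≡0 (sumBelow k f) eq

⇒sumBelow≡0 : (f : ℕ → ℕ) (k : ℕ) → (∀ i → i < k → f i ≡ 0) → sumBelow k f ≡ 0
⇒sumBelow≡0 f zero    eq = refl
⇒sumBelow≡0 f (suc k) eq = cong₂ _+_ (⇒sumBelow≡0 f k (λ i → eq i ∘ m<n⇒m<1+n)) (eq k ≤-refl)

indicator : ℕ → ℕ → ℕ
indicator z w = b2n (does (w ≟ z))

indicator-≢ : {z w : ℕ} → w ≢ z → indicator z w ≡ 0
indicator-≢ {z} {w} w≢z = cong b2n (dec-false (w ≟ z) w≢z)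

indicator-refl : (z : ℕ) → indicator z z ≡ 1
indicator-refl z = cong b2n (dec-true (z ≟ z) refl)

sumBelow-indicator : {z k : ℕ} → z < k → sumBelow k (indicator z) ≡ 1
sumBelow-indicator {z} {suc k} z<1+k with m≤n⇒m<n∨m≡n (s≤s⁻¹ z<1+k)
... | inj₁ z<k  = cong₂ _+_ (sumBelow-indicator z<k) (indicator-≢ (>⇒≢ z<k))
... | inj₂ refl = cong₂ _+_ (⇒sumBelow≡0 (indicator z) z (λ i i<z → indicator-≢ (<⇒≢ i<z))) (indicator-refl z)

-- An element with q others on each side needs `suc (q + q)` in total; the upper bound says that
-- doubling q loses at most 2.
halve : {c : ℕ} → 0 < c → ∃ λ q → suc (q + q) ≤ c × c ≤ suc (suc (q + q))
halve {suc zero}          _ = 0 , s≤s z≤n , s≤s z≤n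
halve {suc (suc zero)}    _ = 0 , s≤s z≤n , ≤-refl
halve {suc (suc (suc c))} _ with q , lo , hi ← halve {suc c} z<s =
  suc q , s≤s (subst (_≤ suc (suc c)) (cong suc (sym (+-suc q q))) (s≤s lo))
        , s≤s (subst (suc (suc c) ≤_) (cong (λ r → suc (suc r)) (sym (+-suc q q))) (s≤s hi))

double-cancel-≤ : {k u : ℕ} → k + k ≤ u + u → k ≤ u
double-cancel-≤ {k} {u} le with k ≤? u
... | yes k≤u = k≤u
... | no  k≰u = contradiction le (<⇒≱ (+-mono-< (≰⇒> k≰u) (≰⇒> k≰u)))

-- Counting the elements of an interval of 𝓛

module Counting (𝓛 : CompLinOrder) where
  open CompLinOrder 𝓛 renaming (trans to lt-trans)

  Between : ℕ → ℕ → ℕ → Set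
  Between x y w = inL w ≡ true × lt x w ≡ true × lt w y ≡ true

  inside : ℕ → ℕ → ℕ → ℕ
  inside x y w = b2n (inL w) * (b2n (lt x w) * b2n (lt w y))

  inside-1 : {x y w : ℕ} → Between x y w → inside x y w ≡ 1
  inside-1 (p , q , r) rewrite p | q | r = refl

  inside-cases : (x y w : ℕ) → Between x y w ⊎ inside x y w ≡ 0
  inside-cases x y w with inL w | lt x w | lt w y
  ... | true  | true  | true  = inj₁ (refl , refl , refl)
  ... | true  | true  | false = inj₂ refl
  ... | true  | false | _     = inj₂ refl
  ... | false | _     | _     = inj₂ refl

  inside⇒Between : {x y w : ℕ} → 1 ∸ inside x y w ≡ 0 → Between x y w
  inside⇒Between {x} {y} {w} eq with inside-cases x y w
  ... | inj₁ bt  = bt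
  ... | inj₂ eq′ = contradiction (trans (sym (cong (1 ∸_) eq′)) eq) λ ()

  lt-asym : {x y : ℕ} → inL x ≡ true → inL y ≡ true → lt x y ≡ true → lt y x ≡ false
  lt-asym {x} {y} x∈L y∈L x<y with lt y x in y<x
  ... | false = refl
  ... | true  = trans (sym (lt-trans x y x x∈L y∈L x∈L x<y y<x)) (irrefl x x∈L)

  lt⇒≢ : {x y : ℕ} → inL x ≡ true → lt x y ≡ true → x ≢ y
  lt⇒≢ {x} x∈L x<x refl = contradiction (trans (sym x<x) (irrefl x x∈L)) λ ()

  -- `s` bounds the elements counted as natural numbers, which keeps the count finite and computable
  -- even if the interval is infinite.
  count : ℕ → ℕ → ℕ → ℕ
  count s x y = sumBelow s (inside x y)

  count-mono : {s t : ℕ} (x y : ℕ) → s ≤ t → count s x y ≤ count t x y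
  count-mono x y = sumBelow-mono (inside x y)

  count-step : {x y w : ℕ} → Between x y w → count (suc w) x y ≡ suc (count w x y)
  count-step {x} {y} {w} bt = trans (cong (count w x y +_) (inside-1 bt)) (+-comm _ 1)

  -- The count rises by one exactly at the elements of the interval, so no value is skipped. Ranks
  -- follow the order of the natural numbers, not that of 𝓛.
  ranked : (s x y i : ℕ) → i < count s x y → ∃ λ w → w < s × Between x y w × count w x y ≡ i
  ranked (suc s) x y i lt with i <? count s x y | inside-cases x y s
  ... | yes i<c | _ = let w , w<s , bt , eq = ranked s x y i i<c in w , m<n⇒m<1+n w<s , bt , eq
  ... | no  i≮c | inj₂ eq = contradiction (subst (i <_) (trans (cong (count s x y +_) eq) (+-identityʳ _)) lt) i≮c
  ... | no  i≮c | inj₁ bt = s , ≤-refl , bt , ≤-antisym (≮⇒≥ i≮c) (s≤s⁻¹ (subst (i <_) (count-step bt) lt))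

  count-< : {x y v w : ℕ} → Between x y v → v < w → count v x y < count w x y
  count-< {x} {y} {v} {w} bt v<w = subst (_≤ count w x y) (count-step bt) (count-mono x y v<w)

  rank-injective : {x y v w : ℕ} → Between x y v → Between x y w → count v x y ≡ count w x y → v ≡ w
  rank-injective {v = v} {w} bv bw eq with <-cmp v w
  ... | tri< v<w _ _ = contradiction eq (<⇒≢ (count-< bv v<w))
  ... | tri≈ _ v≡w _ = v≡w
  ... | tri> _ _ w<v = contradiction eq (>⇒≢ (count-< bw w<v))

  -- Trichotomy puts each element of (x, y) into exactly one of (x, z), {z} and (z, y); summing over
  -- w gives `count-split`.
  inside-split : {x y z : ℕ} → inL x ≡ true → inL y ≡ true → Between x y z → (w : ℕ) →
                 inside x y w ≡ (inside x z w + inside z y w) + indicator z w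
  inside-split {x} {y} {z} x∈L y∈L (z∈L , x<z , z<y) w with inL w in w∈L
  ... | false = sym (indicator-≢ {z} {w} λ { refl → contradiction (trans (sym w∈L) z∈L) λ () })
  ... | true with trich w z w∈L z∈L
  ...   | inj₁ w<z
    rewrite w<z | lt-asym w∈L z∈L w<z | lt-trans w z y w∈L z∈L y∈L w<z z<y
          | indicator-≢ (lt⇒≢ w∈L w<z) = sym (trans (+-identityʳ _) (+-identityʳ _))
  ...   | inj₂ (inj₁ refl) rewrite x<z | z<y | irrefl z z∈L | indicator-refl z = refl
  ...   | inj₂ (inj₂ z<w)
    rewrite z<w | lt-asym z∈L w∈L z<w | lt-trans x z w x∈L z∈L w∈L x<z z<w
          | indicator-≢ (lt⇒≢ z∈L z<w ∘ sym) | *-zeroʳ (b2n true) = sym (+-identityʳ _)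

  count-split : {s x y z : ℕ} → inL x ≡ true → inL y ≡ true → Between x y z → z < s →
                count s x y ≡ suc (count s x z + count s z y)
  count-split {s} {x} {y} {z} x∈L y∈L bt below = begin
    count s x y
      ≡⟨ sumBelow-cong (inside-split x∈L y∈L bt) s ⟩
    sumBelow s (λ w → (inside x z w + inside z y w) + indicator z w)
      ≡⟨ sumBelow-+ (λ w → inside x z w + inside z y w) (indicator z) s ⟩
    sumBelow s (λ w → inside x z w + inside z y w) + sumBelow s (indicator z)
      ≡⟨ cong₂ _+_ (sumBelow-+ (inside x z) (inside z y) s) (sumBelow-indicator {z} {s} below) ⟩
    (count s x z + count s z y) + 1
      ≡⟨ +-comm _ 1 ⟩
    suc (count s x z + count s z y) ∎
    where open ≡-Reasoning

  -- Quickselect: an arbitrary element of the interval serves as pivot.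
  select : (fuel s x y i j : ℕ) → count s x y ≤ fuel → inL x ≡ true → inL y ≡ true →
           suc (i + j) ≤ count s x y →
           ∃ λ z → z < s × Between x y z × i ≤ count s x z × j ≤ count s z y
  select zero s x y i j c≤0 _ _ big = contradiction (≤-trans big c≤0) λ ()
  select (suc fuel) s x y i j c≤fuel x∈L y∈L big
    with z , below , bt@(z∈L , x<z , z<y) , _ ← ranked s x y 0 (≤-trans (s≤s z≤n) big)
    with split ← count-split {s} x∈L y∈L bt below
    with i ≤? count s x z | j ≤? count s z y
  ... | yes i≤ | yes j≤ = z , below , bt , i≤ , j≤
  -- Too few elements lie left of the pivot: continue in (z, y), where i less the pivot and the
  -- elements left of it remain to be found.
  ... | no i≰ | _ =
    let i′ , eq = m≤n⇒∃[o]m+o≡n (≰⇒> i≰)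
        z′ , below′ , bt′@(z′∈L , z<z′ , z′<y) , i≤ , j≤ =
          select fuel s z y i′ j
            (≤-trans (m≤n+m (count s z y) (count s x z)) (s≤s⁻¹ (subst (_≤ suc fuel) split c≤fuel))) z∈L y∈L
            (+-cancelˡ-≤ (count s x z) _ _
              (subst (_≤ count s x z + count s z y)
                (trans (cong (_+ j) (sym eq)) (trans (cong suc (+-assoc (count s x z) i′ j)) (sym (+-suc _ _))))
                (s≤s⁻¹ (subst (suc (i + j) ≤_) split big))))
        x<z′ = lt-trans x z z′ x∈L z∈L z′∈L x<z z<z′
    in z′ , below′ , (z′∈L , x<z′ , z′<y)
       , subst₂ _≤_ eq (sym (count-split {s} x∈L z′∈L (z∈L , x<z , z<z′) below)) (s≤s (+-monoʳ-≤ (count s x z) i≤))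
       , j≤
  ... | yes _ | no j≰ =
    let j′ , eq = m≤n⇒∃[o]m+o≡n (≰⇒> j≰)
        z′ , below′ , bt′@(z′∈L , x<z′ , z′<z) , i≤ , j≤ =
          select fuel s x z i j′
            (≤-trans (m≤m+n (count s x z) (count s z y)) (s≤s⁻¹ (subst (_≤ suc fuel) split c≤fuel))) x∈L z∈L
            (+-cancelʳ-≤ (count s z y) _ _
              (subst (_≤ count s x z + count s z y)
                (trans (cong (i +_) (trans (sym eq) (cong suc (+-comm (count s z y) j′))))
                  (trans (+-suc i _) (cong suc (sym (+-assoc i j′ _)))))
                (s≤s⁻¹ (subst (suc (i + j) ≤_) split big))))
        z′<y = lt-trans z′ z y z′∈L z∈L y∈L z′<z z<y
    in z′ , below′ , (z′∈L , x<z′ , z′<y) , i≤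
       , subst₂ _≤_ (trans (cong suc (+-comm j′ _)) eq)
           (sym (count-split {s} z′∈L y∈L (z∈L , z′<z , z<y) below)) (s≤s (+-monoˡ-≤ (count s z y) j≤))

  inLT : Total 1
  inLT .code     = proj₁ inL-computable
  inLT .fun v    = b2n (inL (head v))
  inLT .computes (x ∷ []) = proj₂ inL-computable x

  ltT : Total 2
  ltT .code     = proj₁ lt-computable
  ltT .fun v    = b2n (lt (head v) (head (tail v)))
  ltT .computes (x ∷ y ∷ []) = proj₂ lt-computable x y

  insideT : Total 3
  insideT = mulT (compT inLT (projT zero ∷ []))
                 (mulT (compT ltT (projT (suc zero) ∷ projT zero ∷ []))
                       (compT ltT (projT zero ∷ projT (suc (suc zero)) ∷ [])))

  countT : Total 3
  countT = sumT insideT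

-- Facts that depend on membership in `C` are available only double negated; this collects finitely
-- many of them.
¬¬-bounded-∀ : {P : ℕ → Set} (k : ℕ) → (∀ i → i < k → ¬ ¬ P i) → ¬ ¬ (∀ i → i < k → P i)
¬¬-bounded-∀ zero    p none = none λ _ ()
¬¬-bounded-∀ {P} (suc k) p none =
  ¬¬-bounded-∀ k (λ i i<k → p i (m<n⇒m<1+n i<k)) λ below →
  p k ≤-refl λ pk →
  none λ i i<1+k → [ below i , (λ { refl → pk }) ]′ (m≤n⇒m<n∨m≡n (s≤s⁻¹ i<1+k))

eventually-bounded-∀ : {P : ℕ → ℕ → Set} (k : ℕ) → (∀ i → i < k → Eventually (P i)) →
                       Eventually (λ s → ∀ i → i < k → P i s)
eventually-bounded-∀ zero    p = 0 , λ _ _ _ ()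
eventually-bounded-∀ (suc k) p =
  eventually-map (λ s → λ { (below , pk) i i<1+k →
                   [ below i , (λ { refl → pk }) ]′ (m≤n⇒m<n∨m≡n (s≤s⁻¹ i<1+k)) })
    (eventually-∧ (eventually-bounded-∀ k (λ i i<k → p i (m<n⇒m<1+n i<k))) (p k ≤-refl))

-- Stage approximations of interval counts

module Stages (𝓛 : CompLinOrder) where
  open CompLinOrder 𝓛 using (inL; lt)
  open Counting 𝓛

  -- The number of elements of the interval (a(n), b(n)) seen at stage s, capped at n so that it is finite.
  stageCountT : PR 1 → PR 1 → Total 2
  stageCountT a b =
    minT (caseT (step a) zeroT
           (caseT (weakenT (step b)) zeroT
             (compT countT (projT (suc (suc zero)) ∷ projT (suc zero) ∷ projT zero ∷ []))))
         (projT (suc zero))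

  stageCount : PR 1 → PR 1 → ℕ → ℕ → ℕ
  stageCount a b s n = fun (stageCountT a b) (s ∷ n ∷ [])

  stageCount≤ : (a b : PR 1) (s n : ℕ) → stageCount a b s n ≤ n
  stageCount≤ a b s n = m⊓n≤n (caseℕ (fun (step a) (s ∷ n ∷ [])) 0 _) n

  -- An undecided value gives count 0, so a positive count certifies that `a` and `b` have both
  -- halted.
  stageCount-sound : (a b : PR 1) (s n : ℕ) {k : ℕ} → suc k ≤ stageCount a b s n →
                     ∃₂ λ x y → a ⟨ n ⟩⇓ x × b ⟨ n ⟩⇓ y × suc k ≤ count s x y
  stageCount-sound a b s n le
    with fun (step a) (s ∷ n ∷ []) in eq₁ | fun (step b) (s ∷ n ∷ []) in eq₂ | ≤-trans le (m⊓n≤m _ n)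
  ... | suc x | suc y | le′ = x , y , step-sound a s _ eq₁ , step-sound b s _ eq₂ , le′

  stageCount-complete : {a b : PR 1} {n s₀ k x y : ℕ} → a ⟨ n ⟩⇓ x → b ⟨ n ⟩⇓ y → k ≤ count s₀ x y → k ≤ n →
                        Eventually (λ s → k ≤ stageCount a b s n)
  stageCount-complete {a} {b} {n} {s₀} {k} {x} {y} a⇓ b⇓ k≤c k≤n =
    eventually-map (λ s → λ { ((eq₁ , eq₂) , s₀≤s) → go s eq₁ eq₂ s₀≤s })
      (eventually-∧ (eventually-∧ (step-complete a⇓) (step-complete b⇓)) (s₀ , λ _ s₀≤s → s₀≤s))
    where
    go : ∀ s → fun (step a) (s ∷ n ∷ []) ≡ suc x → fun (step b) (s ∷ n ∷ []) ≡ suc y → s₀ ≤ s →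
         k ≤ stageCount a b s n
    go s eq₁ eq₂ s₀≤s rewrite eq₁ | eq₂ = ⊓-glb (≤-trans k≤c (count-mono x y s₀≤s)) k≤n

  -- Values seen at one stage reappear at all late stages, where the count of their interval has not
  -- dropped.
  stageCount-persists : (a b : PR 1) (s n k : ℕ) → k ≤ stageCount a b s n →
                        Eventually (λ s → k ≤ stageCount a b s n)
  stageCount-persists a b s n zero    _  = 0 , λ _ _ → z≤n
  stageCount-persists a b s n (suc k) le =
    let _ , _ , a⇓ , b⇓ , le′ = stageCount-sound a b s n le in
    stageCount-complete {s₀ = s} a⇓ b⇓ le′ (≤-trans le (stageCount≤ a b s n))

-- Reasoning almost everywhere on a cohesive set

module Power (𝓛 : CompLinOrder) (C : ℕ → Set) (coce : CoCE C) (coh : Cohesive C) where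
  open CompLinOrder 𝓛 renaming (trans to lt-trans)
  open CohesivePower 𝓛 C
  open Counting 𝓛
  open Stages 𝓛

  -- The relation C ⊆* P behaves like a consistent ¬¬-closed modality on P.

  ae-bind : {P Q : ℕ → Set} → (∀ n → C n → P n → ¬ ¬ Q n) → C ⊆* P → C ⊆* Q
  -- The goal `n < N` is decidable, hence stable, so double negations can be removed.
  ae-bind f (N , p) = N , λ n → λ { (c , ¬q) → decidable-stable (n <? N) λ n≮N →
    n≮N (p n (c , λ pn → f n c pn ¬q)) }

  ae-map : {P Q : ℕ → Set} → (∀ n → C n → P n → Q n) → C ⊆* P → C ⊆* Q
  ae-map f = ae-bind λ n c p ¬q → ¬q (f n c p)

  ae-pure : {P : ℕ → Set} → (∀ n → C n → P n) → C ⊆* P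
  ae-pure p = 0 , λ n → λ { (c , ¬p) → contradiction (p n c) ¬p }

  ae-≥ : (N : ℕ) → C ⊆* (N ≤_)
  ae-≥ N = N , λ n → λ { (_ , N≰n) → ≰⇒> N≰n }

  ae-∧ : {P Q : ℕ → Set} → C ⊆* P → C ⊆* Q → C ⊆* (λ n → P n × Q n)
  ae-∧ {P} {Q} (N , p) (M , q) = N ⊔ M , λ n → λ { (c , ¬pq) → decidable-stable (n <? N ⊔ M) λ n≮ →
    let N≤n = m⊔n≤o⇒m≤o N M (≮⇒≥ n≮)
        M≤n = m⊔n≤o⇒n≤o N M (≮⇒≥ n≮)
    in <⇒≱ (p n (c , λ pn → <⇒≱ (q n (c , λ qn → ¬pq (pn , qn))) M≤n)) N≤n }

  ae-consistent : ¬ (C ⊆* λ _ → ⊥)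
  ae-consistent (N , p) = proj₁ coh (N , λ n c → p n (c , λ ()))

  ae-absurd : {P Q : ℕ → Set} → C ⊆* P → C ⊆* Q → ¬ (∀ n → C n → P n → ¬ Q n)
  ae-absurd p q clash = ae-consistent (ae-map (λ { n c (pn , qn) → clash n c pn qn }) (ae-∧ p q))

  -- Infinity of `C` is a negative statement, so it yields an element only under double negation.
  ae-witness : {P : ℕ → Set} → C ⊆* P → ¬ ¬ (∃ λ n → C n × P n)
  ae-witness p none = ae-consistent (ae-map (λ n c pn → none (n , c , pn)) p)

  opaque
    -- Cohesiveness; later dichotomies along `C` come from presenting a property as the domain of a
    -- code.
    ae-dec : (e : PR 1) → C ⊆* Halts e ⊎ C ⊆* (λ n → ¬ Halts e n)
    ae-dec e with proj₂ coh e
    ... | inj₁ ae      = inj₁ ae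
    ... | inj₂ (N , p) = inj₂ (N , λ n → λ { (c , ¬¬h) → decidable-stable (n <? N) λ n≮N →
                           ¬¬h λ h → n≮N (p n (c , h)) })

  -- The order on the cohesive power

  Related : (ℕ → ℕ → Set) → PR 1 → PR 1 → ℕ → Set
  Related R a b n = ∃₂ λ x y → a ⟨ n ⟩⇓ x × b ⟨ n ⟩⇓ y × R x y

  -- The test `F` with search variable s presents R as c.e., so the n at which the values are
  -- related form the domain of a search.
  ae-dec-Related : {R : ℕ → ℕ → Set} (F : Total 3) →
                   (∀ {s x y} → fun F (s ∷ x ∷ y ∷ []) ≡ 0 → R x y) →
                   (∀ {x y} → R x y → ∃ λ s → fun F (s ∷ x ∷ y ∷ []) ≡ 0) →
                   (a b : PR 1) → C ⊆* Related R a b ⊎ C ⊆* (λ n → ¬ Related R a b n)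
  ae-dec-Related F sound complete a b with ae-dec (search F (a ∷ b ∷ []))
  ... | inj₁ ae = inj₁ (ae-map (λ { n _ (_ , d) →
                    let x , y , a⇓ , b⇓ , eq = search-sound₂ F d in x , y , a⇓ , b⇓ , sound eq }) ae)
  ... | inj₂ ae = inj₂ (ae-map (λ { n _ ¬h (x , y , a⇓ , b⇓ , r) →
                    let s , eq = complete r in
                    ¬h (search-complete F (∷⇓ a⇓ (∷⇓ b⇓ []⇓)) s eq) }) ae)

  opaque
    ae-dec-lt : (a b : PR 1) → C ⊆* Related (λ x y → lt x y ≡ true) a b ⊎
                               C ⊆* (λ n → ¬ Related (λ x y → lt x y ≡ true) a b n)
    ae-dec-lt = ae-dec-Related
      (monusT (sucT zeroT) (compT ltT (projT (suc zero) ∷ projT (suc (suc zero)) ∷ [])))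
      (λ {s} {x} {y} → sound x y) (λ r → 0 , cong (λ v → 1 ∸ b2n v) r)
      where
      sound : ∀ x y → 1 ∸ b2n (lt x y) ≡ 0 → lt x y ≡ true
      sound x y eq with lt x y
      ... | true = refl

    ae-dec-≡ : (a b : PR 1) → C ⊆* Related _≡_ a b ⊎ C ⊆* (λ n → ¬ Related _≡_ a b n)
    ae-dec-≡ = ae-dec-Related
      (addT (monusT (projT (suc zero)) (projT (suc (suc zero))))
            (monusT (projT (suc (suc zero))) (projT (suc zero))))
      (λ {s} {x} {y} eq → ≤-antisym (m∸n≡0⇒m≤n (m+n≡0⇒m≡0 (x ∸ y) eq)) (m∸n≡0⇒m≤n (m+n≡0⇒n≡0 (x ∸ y) eq)))
      (λ { {x} refl → 0 , cong₂ _+_ (n∸n≡0 x) (n∸n≡0 x) })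

  Related-≡⇒=C : {a b : Elt} → C ⊆* Related _≡_ (fn a) (fn b) → a =C b
  Related-≡⇒=C = ae-map λ { n _ (x , .x , a⇓ , b⇓ , refl) → x , a⇓ , b⇓ }

  data Tri (a b : Elt) : Set where
    below : a ≺C b → Tri a b
    equal : a =C b → Tri a b
    above : b ≺C a → Tri a b

  -- Each of the three relations holds or fails almost everywhere on `C`; if all failed, trichotomy
  -- in 𝓛 would be violated.
  compare : (a b : Elt) → Tri a b
  compare a b with ae-dec-lt (fn a) (fn b) | ae-dec-≡ (fn a) (fn b) | ae-dec-lt (fn b) (fn a)
  ... | inj₁ a≺b | _        | _        = below a≺b
  ... | inj₂ _   | inj₁ a=b | _        = equal (Related-≡⇒=C {a} {b} a=b)
  ... | inj₂ _   | inj₂ _   | inj₁ b≺a = above b≺a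
  ... | inj₂ a⊀b | inj₂ a≠b | inj₂ b⊀a = ⊥-elim (ae-absurd (ae-∧ (domC a) (domC b)) (ae-∧ a⊀b (ae-∧ a≠b b⊀a))
    λ { n _ ((x , a⇓) , (y , b⇓)) (¬lt , ¬eq , ¬gt) →
        case trich x y (range a n x a⇓) (range b n y b⇓) of λ
          { (inj₁ x<y)        → ¬lt (x , y , a⇓ , b⇓ , x<y)
          ; (inj₂ (inj₁ x≡y)) → ¬eq (x , y , a⇓ , b⇓ , x≡y)
          ; (inj₂ (inj₂ y<x)) → ¬gt (y , x , b⇓ , a⇓ , y<x) } })

  ≺-asym : {a b : Elt} → a ≺C b → ¬ (b ≺C a)
  ≺-asym {a} {b} a≺b b≺a = ae-absurd a≺b b≺a λ { n _ (x , y , a⇓ , b⇓ , x<y) (y′ , x′ , b⇓′ , a⇓′ , y′<x′) →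
    case (⇓-deterministic a⇓ a⇓′ , ⇓-deterministic b⇓ b⇓′) of λ { (refl , refl) →
      contradiction (trans (sym y′<x′) (lt-asym (range a n x a⇓) (range b n y b⇓) x<y)) λ () } }

  =C-sym : {a b : Elt} → a =C b → b =C a
  =C-sym = ae-map λ { n _ (x , a⇓ , b⇓) → x , b⇓ , a⇓ }

  ⪯-trans : {a b c : Elt} → a ⪯C b → b ⪯C c → a ⪯C c
  ⪯-trans {a} {b} {c} (inj₁ a≺b) (inj₁ b≺c) = inj₁ (ae-map
    (λ { n _ ((x , y , a⇓ , b⇓ , x<y) , (y′ , z , b⇓′ , c⇓ , y<z)) →
      case ⇓-deterministic b⇓ b⇓′ of λ { refl →
        x , z , a⇓ , c⇓ , lt-trans x y z (range a n x a⇓) (range b n y b⇓) (range c n z c⇓) x<y y<z } })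
    (ae-∧ a≺b b≺c))
  ⪯-trans (inj₁ a≺b) (inj₂ b=c) = inj₁ (ae-map
    (λ { n _ ((x , y , a⇓ , b⇓ , x<y) , (y′ , b⇓′ , c⇓)) →
      case ⇓-deterministic b⇓ b⇓′ of λ { refl → x , y , a⇓ , c⇓ , x<y } })
    (ae-∧ a≺b b=c))
  ⪯-trans (inj₂ a=b) (inj₁ b≺c) = inj₁ (ae-map
    (λ { n _ ((x , a⇓ , b⇓) , (y , z , b⇓′ , c⇓ , y<z)) →
      case ⇓-deterministic b⇓ b⇓′ of λ { refl → x , z , a⇓ , c⇓ , y<z } })
    (ae-∧ a=b b≺c))
  ⪯-trans (inj₂ a=b) (inj₂ b=c) = inj₂ (ae-map
    (λ { n _ ((x , a⇓ , b⇓) , (y , b⇓′ , c⇓)) →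
      case ⇓-deterministic b⇓ b⇓′ of λ { refl → x , a⇓ , c⇓ } })
    (ae-∧ a=b b=c))

  ≺⇒⋡ : {a b : Elt} → a ≺C b → ¬ (b ⪯C a)
  ≺⇒⋡ {a} {b} a≺b (inj₁ b≺a) = ≺-asym {a} {b} a≺b b≺a
  ≺⇒⋡ {a} {b} a≺b (inj₂ b=a) = ae-absurd a≺b b=a λ { n _ (x , y , a⇓ , b⇓ , x<y) (z , b⇓′ , a⇓′) →
    lt⇒≢ (range a n x a⇓) x<y (trans (⇓-deterministic a⇓ a⇓′) (⇓-deterministic b⇓′ b⇓)) }

  ≺⊎⪰ : (a b : Elt) → a ≺C b ⊎ b ⪯C a
  ≺⊎⪰ a b with compare a b
  ... | below a≺b = inj₁ a≺b
  ... | equal a=b = inj₂ (inj₂ (=C-sym {a} {b} a=b))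
  ... | above b≺a = inj₂ (inj₁ b≺a)

  InBlock-refl : (a : Elt) → InBlock a a
  InBlock-refl a = a ∷ [] , λ z → λ
    { (inj₁ (a⪯z , z⪯a)) → here (squeeze z a⪯z z⪯a)
    ; (inj₂ (a⪯z , z⪯a)) → here (squeeze z a⪯z z⪯a) }
    where
    squeeze : ∀ z → a ⪯C z → z ⪯C a → z =C a
    squeeze z _         (inj₂ z=a) = z=a
    squeeze z a⪯z (inj₁ z≺a) = ⊥-elim (≺⇒⋡ {z} {a} z≺a a⪯z)

  -- Finite intervals of the cohesive power

  -- The existential bound s makes "at least k elements in (a(n), b(n))" a c.e. condition on n.
  Many : PR 1 → PR 1 → ℕ → ℕ → Set
  Many a b k = Related (λ x y → ∃ λ s → k ≤ count s x y) a b

  Unbounded : PR 1 → PR 1 → Set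
  Unbounded a b = ∀ k → C ⊆* Many a b k

  opaque
    ae-dec-Many : (a b : PR 1) (k : ℕ) → C ⊆* Many a b k ⊎ C ⊆* (λ n → ¬ Many a b k n)
    ae-dec-Many a b k = ae-dec-Related
      (monusT (numeralT k) countT)
      (λ {s} {x} {y} eq → s , m∸n≡0⇒m≤n {k} {count s x y} eq)
      (λ { (s , le) → s , m≤n⇒m∸n≡0 le }) a b

  -- On w ∷ x ∷ y this vanishes exactly when w lies in (x, y) with rank i; the last two differences
  -- together encode an equation.
  nthT : ℕ → Total 3
  nthT i = addT (monusT (sucT zeroT) (compT insideT (projT zero ∷ projT (suc zero) ∷ projT (suc (suc zero)) ∷ [])))
                (addT (monusT (numeralT i) countT) (monusT countT (numeralT i)))

  NthValue : PR 1 → PR 1 → ℕ → ℕ → ℕ → Set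
  NthValue a b i n w = Related (λ x y → Between x y w × count w x y ≡ i) a b n

  opaque
    nth : PR 1 → PR 1 → ℕ → PR 1
    nth a b i = search (nthT i) (a ∷ b ∷ [])

    nth-sound : (a b : PR 1) (i : ℕ) {n w : ℕ} → nth a b i ⟨ n ⟩⇓ w → NthValue a b i n w
    nth-sound a b i {n} {w} d =
      let x , y , a⇓ , b⇓ , eq = search-sound₂ (nthT i) d
          eq′ = m+n≡0⇒n≡0 (1 ∸ inside x y w) eq
      in x , y , a⇓ , b⇓ , inside⇒Between (m+n≡0⇒m≡0 (1 ∸ inside x y w) eq)
           , ≤-antisym (m∸n≡0⇒m≤n (m+n≡0⇒n≡0 (i ∸ count w x y) eq′))
                       (m∸n≡0⇒m≤n (m+n≡0⇒m≡0 (i ∸ count w x y) eq′))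

    nth-halts : {a b : PR 1} {i n w : ℕ} → NthValue a b i n w → Halts (nth a b i) n
    nth-halts {w = w} (x , y , a⇓ , b⇓ , bt , refl) =
      search-complete (nthT (count w x y)) (∷⇓ a⇓ (∷⇓ b⇓ []⇓)) w
        (cong₂ _+_ (cong (1 ∸_) (inside-1 bt)) (cong₂ _+_ (n∸n≡0 (count w x y)) (n∸n≡0 (count w x y))))

  NthValue-unique : {a b : PR 1} {i n v w : ℕ} → NthValue a b i n v → NthValue a b i n w → v ≡ w
  NthValue-unique (x , y , a⇓ , b⇓ , bt , eq) (x′ , y′ , a⇓′ , b⇓′ , bt′ , eq′)
    with refl ← ⇓-deterministic a⇓ a⇓′ | refl ← ⇓-deterministic b⇓ b⇓′ = rank-injective bt bt′ (trans eq (sym eq′))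

  nth-complete : {a b : PR 1} {i n w : ℕ} → NthValue a b i n w → nth a b i ⟨ n ⟩⇓ w
  nth-complete {a} {b} {i} {n} v =
    let w′ , d = nth-halts v
    in subst (nth a b i ⟨ n ⟩⇓_) (NthValue-unique {a} {b} (nth-sound a b i d) v) d

  nthElt : (a b : Elt) (i : ℕ) → C ⊆* Halts (nth (fn a) (fn b) i) → Elt
  nthElt a b i d .fn          = nth (fn a) (fn b) i
  nthElt a b i d .domC        = d
  nthElt a b i d .range n w h = let _ , _ , _ , _ , (w∈L , _) , _ = nth-sound (fn a) (fn b) i h in w∈L

  nthElts : (a b : Elt) → ℕ → List Elt
  nthElts a b zero    = []
  nthElts a b (suc k) with ae-dec (nth (fn a) (fn b) k)
  ... | inj₁ d = nthElt a b k d ∷ nthElts a b k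
  ... | inj₂ _ = nthElts a b k

  nthElts-cover : (a b z : Elt) (k : ℕ) → Any (z =C_) (nthElts a b k) ⊎
    C ⊆* (λ n → ∀ i → i < k → ¬ Related _≡_ (fn z) (nth (fn a) (fn b) i) n)
  nthElts-cover a b z zero = inj₂ (ae-pure λ _ _ _ ())
  nthElts-cover a b z (suc k)
    with ae-dec (nth (fn a) (fn b) k) | ae-dec-≡ (fn z) (nth (fn a) (fn b) k) | nthElts-cover a b z k
  ... | inj₁ d   | inj₁ z=nth | _        = inj₁ (here (Related-≡⇒=C {z} {nthElt a b k d} z=nth))
  ... | inj₁ _   | inj₂ _     | inj₁ any = inj₁ (there any)
  ... | inj₂ _   | _          | inj₁ any = inj₁ any
  -- A function undefined almost everywhere on `C` cannot agree with z there.
  ... | inj₂ ¬d  | inj₁ z=nth | inj₂ _   =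
    ⊥-elim (ae-absurd ¬d z=nth λ { n _ ¬h (_ , w , _ , d , _) → ¬h (w , d) })
  ... | _        | inj₂ z≠nth | inj₂ ae  = inj₂ (ae-map
    (λ { n _ (¬last , ¬below) i i<1+k →
       [ ¬below i , (λ { refl → ¬last }) ]′ (m≤n⇒m<n∨m≡n (s≤s⁻¹ i<1+k)) }) (ae-∧ z≠nth ae))

  -- If z lies strictly between, z(n) has rank below k for almost all n in `C`. The rank may vary
  -- with n, but each single rank is matched or missed almost everywhere, and they cannot all be
  -- missed.
  finite-if-few : (a b : Elt) (k : ℕ) → a ≺C b → C ⊆* (λ n → ¬ Many (fn a) (fn b) k n) → FiniteInterval a b
  finite-if-few a b k a≺b few = a ∷ b ∷ nthElts a b k , λ z → λ
    { (inj₁ (inj₂ a=z , _))          → here (=C-sym {a} {z} a=z)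
    ; (inj₁ (_ , inj₂ z=b))          → there (here z=b)
    ; (inj₁ (inj₁ a≺z , inj₁ z≺b))   → there (there (strict z a≺z z≺b))
    ; (inj₂ (b⪯z , z⪯a))             → ⊥-elim (≺⇒⋡ {a} {b} a≺b (⪯-trans {b} {z} {a} b⪯z z⪯a)) }
    where
    strict : ∀ z → a ≺C z → z ≺C b → Any (z =C_) (nthElts a b k)
    strict z a≺z z≺b with nthElts-cover a b z k
    ... | inj₁ any = any
    ... | inj₂ ae  = ⊥-elim (ae-absurd (ae-∧ a≺z z≺b) (ae-∧ few ae)
      λ { n _ ((x , w , a⇓ , z⇓ , x<w) , (w′ , y , z⇓′ , b⇓ , w<y)) (¬many , ¬nth) →
        case ⇓-deterministic z⇓ z⇓′ of λ { refl →
          ¬nth (count w x y) (≰⇒> λ k≤c → ¬many (x , y , a⇓ , b⇓ , w , k≤c))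
            (w , w , z⇓ , nth-complete (x , y , a⇓ , b⇓ , (range z n w z⇓ , x<w , w<y) , refl) , refl) } })

  infinite⇒unbounded : (a b : Elt) → a ≺C b → ¬ FiniteInterval a b → Unbounded (fn a) (fn b)
  infinite⇒unbounded a b a≺b ¬fin k with ae-dec-Many (fn a) (fn b) k
  ... | inj₁ many = many
  ... | inj₂ few  = contradiction (finite-if-few a b k a≺b few) ¬fin

  -- Values of different rank are different; among one more rank than `l` has entries, two would
  -- share an entry.
  unbounded⇒infinite : (a b : Elt) → Unbounded (fn a) (fn b) → ¬ FiniteInterval a b
  unbounded⇒infinite a b unb (l , cover) = clash (Fin.pigeonhole (n<1+n (length l)) (λ i → index (covered i)))
    where
    halts : ∀ i → C ⊆* Halts (nth (fn a) (fn b) i)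
    halts i = ae-map (λ { n _ (x , y , a⇓ , b⇓ , s , le) →
                let w , _ , bt , eq = ranked s x y i le in nth-halts (x , y , a⇓ , b⇓ , bt , eq) })
              (unb (suc i))
    E : ℕ → Elt
    E i = nthElt a b i (halts i)
    covered : (i : Fin (suc (length l))) → Any (E (toℕ i) =C_) l
    covered i = cover (E (toℕ i)) (inj₁
      ( inj₁ (ae-map (λ { n _ (w , d) →
          let x , _ , a⇓ , _ , (_ , x<w , _) , _ = nth-sound (fn a) (fn b) (toℕ i) d
          in x , w , a⇓ , d , x<w }) (halts (toℕ i)))
      , inj₁ (ae-map (λ { n _ (w , d) →
          let _ , y , _ , b⇓ , (_ , _ , w<y) , _ = nth-sound (fn a) (fn b) (toℕ i) d
          in w , y , d , b⇓ , w<y }) (halts (toℕ i)))))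
    hit : ∀ i {c} → E i =C c → C ⊆* Related _≡_ (nth (fn a) (fn b) i) (fn c)
    hit i = ae-map λ { n _ (w , d , c⇓) → w , w , d , c⇓ , refl }
    clash : (∃₂ λ i j → toℕ i < toℕ j × index (covered i) ≡ index (covered j)) → ⊥
    clash (i , j , i<j , eq) =
      ae-absurd (hit (toℕ i) {List.lookup l (index (covered i))} (lookup-index (covered i)))
                (subst (λ c → C ⊆* Related _≡_ (nth (fn a) (fn b) (toℕ j)) (fn (List.lookup l c))) (sym eq)
                       (hit (toℕ j) {List.lookup l (index (covered j))} (lookup-index (covered j))))
        λ { n _ (w , .w , d , l⇓ , refl) (w′ , .w′ , d′ , l⇓′ , refl) →
          case ⇓-deterministic l⇓ l⇓′ of λ { refl →
          case (nth-sound (fn a) (fn b) (toℕ i) d , nth-sound (fn a) (fn b) (toℕ j) d′) of λ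
            { ((x , y , a⇓ , b⇓ , _ , eq₁) , (x′ , y′ , a⇓′ , b⇓′ , _ , eq₂)) →
          case (⇓-deterministic a⇓ a⇓′ , ⇓-deterministic b⇓ b⇓′) of λ { (refl , refl) →
            <⇒≢ i<j (trans (sym eq₁) eq₂) } } } }

  -- If y ⪯ x, the finite intervals [a, x] and [y, b] would cover [a, b].
  infinite⇒BlockLt : (a b : Elt) → a ≺C b → ¬ FiniteInterval a b → BlockLt a b
  infinite⇒BlockLt a b a≺b ¬fin x y (lx , coverx) (ly , covery) with ≺⊎⪰ x y
  ... | inj₁ x≺y = x≺y
  ... | inj₂ y⪯x = ⊥-elim (¬fin (lx ++ ly , λ z → λ
    { (inj₂ (b⪯z , z⪯a)) → ⊥-elim (≺⇒⋡ {a} {b} a≺b (⪯-trans {b} {z} {a} b⪯z z⪯a))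
    ; (inj₁ (a⪯z , z⪯b)) → case ≺⊎⪰ x z of λ
        { (inj₁ x≺z) → ++⁺ʳ lx (covery z (inj₂ (⪯-trans {y} {x} {z} y⪯x (inj₁ x≺z) , z⪯b)))
        ; (inj₂ z⪯x) → ++⁺ˡ (coverx z (inj₁ (a⪯z , z⪯x))) } }))

  BlockLt⇒≺ : (a b : Elt) → BlockLt a b → a ≺C b
  BlockLt⇒≺ a b blt = blt a b (InBlock-refl a) (InBlock-refl b)

  -- A finite [a, b] would put b into the block of a and hence strictly below itself.
  BlockLt⇒infinite : (a b : Elt) → BlockLt a b → ¬ FiniteInterval a b
  BlockLt⇒infinite a b blt fin =
    let b≺b = blt b b fin (InBlock-refl b) in ≺-asym {b} {b} b≺b b≺b

  -- An element infinitely far from both ends of an interval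

  module Middle (a b : Elt) (unb : Unbounded (fn a) (fn b)) where

    A B leave : PR 1
    A     = fn a
    B     = fn b
    leave = proj₁ coce

    seen : ℕ → ℕ → ℕ
    seen = stageCount A B

    -- `leave` halts exactly outside `C`, so its halting certifies that m is not in `C`.
    Left : ℕ → ℕ → Set
    Left s m = ∃ λ v → fun (step leave) (s ∷ m ∷ []) ≡ suc v

    -- The bound `n ≤ s` drives the stages to infinity with n, past any stage that matters for a
    -- fixed rival.
    Settled : ℕ → ℕ → Set
    Settled s n = n ≤ s × (∀ m → m < n → Left s m ⊎ seen s m < seen s n)

    rivalT : Total 3
    rivalT = caseT (compT (step leave) (projT (suc zero) ∷ projT zero ∷ []))
                   (monusT (sucT (compT (stageCountT A B) (projT (suc zero) ∷ projT zero ∷ [])))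
                           (compT (stageCountT A B) (projT (suc zero) ∷ projT (suc (suc zero)) ∷ [])))
                   zeroT

    unsettledT : Total 2
    unsettledT = addT (monusT (projT (suc zero)) (projT zero))
                      -- The first n bounds the sum over rivals; the second is the number they are
                      -- compared with.
                      (compT (sumT rivalT) (projT (suc zero) ∷ projT zero ∷ projT (suc zero) ∷ []))

    unsettled-sound : ∀ s n → fun unsettledT (s ∷ n ∷ []) ≡ 0 → Settled s n
    unsettled-sound s n eq =
      m∸n≡0⇒m≤n (m+n≡0⇒m≡0 (n ∸ s) eq) ,
      λ m m<n → rival m (sumBelow≡0⇒ _ n (m+n≡0⇒n≡0 (n ∸ s) eq) m<n)
      where
      rival : ∀ m → fun rivalT (m ∷ s ∷ n ∷ []) ≡ 0 → Left s m ⊎ seen s m < seen s n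
      rival m eq with fun (step leave) (s ∷ m ∷ [])
      ... | suc v = inj₁ (v , refl)
      ... | zero  = inj₂ (m∸n≡0⇒m≤n eq)

    unsettled-complete : ∀ s n → Settled s n → fun unsettledT (s ∷ n ∷ []) ≡ 0
    unsettled-complete s n (n≤s , beaten) =
      cong₂ _+_ (m≤n⇒m∸n≡0 n≤s) (⇒sumBelow≡0 _ n λ m m<n → rival m (beaten m m<n))
      where
      rival : ∀ m → Left s m ⊎ seen s m < seen s n → fun rivalT (m ∷ s ∷ n ∷ []) ≡ 0
      rival m (inj₁ (v , eq)) rewrite eq = refl
      rival m (inj₂ lt) with fun (step leave) (s ∷ m ∷ [])
      ... | zero  = m≤n⇒m∸n≡0 lt
      ... | suc _ = refl

    opaque
      stage : PR 1
      stage = search unsettledT (proj zero ∷ [])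

      stage-sound : ∀ {n s} → stage ⟨ n ⟩⇓ s → Settled s n
      stage-sound {n} {s} d =
        let u , u⇓ , eq = search-sound₁ unsettledT d in
        unsettled-sound s n (subst (λ u → fun unsettledT (s ∷ u ∷ []) ≡ 0) (⇓-deterministic u⇓ proj⇓) eq)

      stage-halts : ∀ {n} s → Settled s n → Halts stage n
      stage-halts s st = search-complete unsettledT (∷⇓ proj⇓ []⇓) s (unsettled-complete s _ st)

    seen-eventually : ∀ {n k} → Many A B k n → k ≤ n → Eventually (λ s → k ≤ seen s n)
    seen-eventually (x , y , a⇓ , b⇓ , s , k≤c) = stageCount-complete {s₀ = s} a⇓ b⇓ k≤c

    -- If stage were undefined on C beyond N, then the least n in C with at least N elements seen would contradict it.
    ae-stage : C ⊆* Halts stage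
    ae-stage = [ (λ ae → ae) , (λ { (N , p) → ⊥-elim (undefined N p) }) ]′ (ae-dec stage)
      where
      module _ (N : ℕ) (p : ∀ n → C n × ¬ ¬ Halts stage n → n < N) where
        Good : ℕ → Set
        Good n = C n × Eventually (λ s → N ≤ seen s n)
        -- A rival in `C` never shows N elements, by minimality of n; one outside `C` is eventually
        -- seen to leave.
        rivals : ∀ n → (∀ {m} → m < n → ¬ Good m) → ∀ m → m < n →
                 ¬ ¬ Eventually (λ s → Left s m ⊎ seen s m < N)
        rivals n ih m m<n = ¬¬-map
          (λ { (yes c) → 0 , λ s _ → inj₂ (≰⇒> λ N≤ → ih m<n (c , stageCount-persists A B s m N N≤))
             ; (no ¬c) → let y , d = proj₁ (proj₂ coce m) ¬c
                         in eventually-map (λ s eq → inj₁ (y , eq)) (step-complete d) })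
          ¬¬-excluded-middle
        none : ∀ n → ¬ Good n
        none = <-rec (λ n → ¬ Good n) λ { n ih (c , S , good) →
          ¬¬-bounded-∀ n (rivals n ih) λ beaten →
            let T , q = eventually-∧ (eventually-bounded-∀ n beaten) (S ⊔ n , λ _ le → le)
                small , S⊔n≤T = q T ≤-refl
                N≤seen = good T (m⊔n≤o⇒m≤o S n S⊔n≤T)
            -- At stage T every rival is beaten, so `stage` halts at n and n < N; but N elements
            -- seen force N ≤ n by the cap.
            in <⇒≱ (p n (c , λ ¬h → ¬h (stage-halts T
                     ( m⊔n≤o⇒n≤o S n S⊔n≤T
                     , λ m m<n → [ inj₁ , (λ lt → inj₂ (≤-trans lt N≤seen)) ]′ (small m m<n)))))
                   (≤-trans N≤seen (stageCount≤ A B T n)) }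
        undefined : ⊥
        undefined = ae-witness (ae-∧ (unb N) (ae-≥ N)) λ { (n , c , many , N≤n) →
          none n (c , seen-eventually many N≤n) }

    Reaches : ℕ → ℕ → Set
    Reaches k n = ∃ λ s → stage ⟨ n ⟩⇓ s × k ≤ seen s n

    -- A fixed m in C with k elements seen by stage T is a rival of every n above m and T.
    ae-Reaches : ∀ k → C ⊆* Reaches k
    ae-Reaches k = [ ae-map (λ { n _ (s , .n , d , proj⇓ , le) → s , d , le })
                   , (λ ae → ⊥-elim (ae-witness (ae-∧ (unb k) (ae-≥ k)) λ { (m , c , many , k≤m) →
                               overtaken m c (seen-eventually many k≤m) ae })) ]′
      -- The identity `proj zero` supplies n itself as the second value of the relation.
      (ae-dec-Related {λ s n → k ≤ seen s n}
        (monusT (numeralT k) (compT (stageCountT A B) (projT (suc zero) ∷ projT (suc (suc zero)) ∷ [])))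
        (λ {_} {s} {n} eq → m∸n≡0⇒m≤n {k} {seen s n} eq)
        (λ le → 0 , m≤n⇒m∸n≡0 le)
        stage (proj zero))
      where
      overtaken : ∀ m → C m → Eventually (λ s → k ≤ seen s m) →
                  ¬ (C ⊆* λ n → ¬ Related (λ s n → k ≤ seen s n) stage (proj zero) n)
      overtaken m c (T , reached) ae =
        ae-absurd (ae-∧ ae-stage (ae-≥ (suc m ⊔ T))) ae λ { n _ ((s , d) , le) ¬related →
          let n≤s , beaten = stage-sound d in
          case beaten m (m⊔n≤o⇒m≤o (suc m) T le) of λ
            { (inj₁ (v , eq)) → proj₂ (proj₂ coce m) (v , step-sound leave s (m ∷ []) eq) c
            ; (inj₂ lt) → ¬related (s , n , d , proj⇓ ,
                ≤-trans (reached s (≤-trans (m⊔n≤o⇒n≤o (suc m) T le) n≤s)) (<⇒≤ lt)) } }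

    -- The slack of 2 is the rounding loss in `halve`.
    _≤2+2*_ : ℕ → ℕ → Set
    c ≤2+2* u = c ≤ suc (suc (u + u))

    excessT : Total n → Total n → Total n
    excessT F G = monusT F (sucT (sucT (addT G G)))

    middleT : Total 4
    middleT = addT (monusT (sucT zeroT) (compT insideT (z ∷ x ∷ y ∷ [])))
      (addT (excessT (compT countT (s ∷ x ∷ y ∷ [])) (compT countT (s ∷ x ∷ z ∷ [])))
            (excessT (compT countT (s ∷ x ∷ y ∷ [])) (compT countT (s ∷ z ∷ y ∷ []))))
      where
      z = projT zero
      s = projT (suc zero)
      x = projT (suc (suc zero))
      y = projT (suc (suc (suc zero)))

    -- An approximate median, phrased by inequalities that a search can test.
    Balanced : ℕ → ℕ → ℕ → ℕ → Set
    Balanced s x y z = Between x y z × count s x y ≤2+2* count s x z × count s x y ≤2+2* count s z y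

    opaque
      middle : PR 1
      middle = search middleT (stage ∷ A ∷ B ∷ [])

      middle-sound : ∀ {n z} → middle ⟨ n ⟩⇓ z →
        ∃ λ s → stage ⟨ n ⟩⇓ s × Related (λ x y → Balanced s x y z) A B n
      middle-sound {n} {z} d =
        let s , x , y , s⇓ , a⇓ , b⇓ , eq = search-sound₃ middleT d
            eq′ = m+n≡0⇒n≡0 (1 ∸ inside x y z) eq
        in s , s⇓ , x , y , a⇓ , b⇓ , inside⇒Between (m+n≡0⇒m≡0 (1 ∸ inside x y z) eq)
             , m∸n≡0⇒m≤n (m+n≡0⇒m≡0 (count s x y ∸ suc (suc (count s x z + count s x z))) eq′)
             , m∸n≡0⇒m≤n (m+n≡0⇒n≡0 (count s x y ∸ suc (suc (count s x z + count s x z))) eq′)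

      middle-halts : ∀ {n s x y z} → stage ⟨ n ⟩⇓ s → A ⟨ n ⟩⇓ x → B ⟨ n ⟩⇓ y → Balanced s x y z → Halts middle n
      middle-halts {z = z} s⇓ a⇓ b⇓ (bt , le , le′) =
        search-complete middleT (∷⇓ s⇓ (∷⇓ a⇓ (∷⇓ b⇓ []⇓))) z
          (cong₂ _+_ (cong (1 ∸_) (inside-1 bt)) (cong₂ _+_ (m≤n⇒m∸n≡0 le) (m≤n⇒m∸n≡0 le′)))

    balanced-exists : ∀ s x y → inL x ≡ true → inL y ≡ true → 0 < count s x y → ∃ (Balanced s x y)
    balanced-exists s x y x∈L y∈L 0<c =
      let q , lo , hi = halve 0<c
          z , _ , bt , q≤ , q≤′ = select (count s x y) s x y q q ≤-refl x∈L y∈L lo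
      in z , bt , ≤-trans hi (s≤s (s≤s (+-mono-≤ q≤ q≤))) , ≤-trans hi (s≤s (s≤s (+-mono-≤ q≤′ q≤′)))

    middleElt : Elt
    middleElt .fn   = middle
    -- A single element seen at the stage of n already guarantees a median.
    middleElt .domC = ae-map (λ { n _ (s , s⇓ , 1≤seen) →
      let x , y , a⇓ , b⇓ , 0<c = stageCount-sound A B s n 1≤seen
          _ , bal = balanced-exists s x y (range a n x a⇓) (range b n y b⇓) 0<c
      in middle-halts s⇓ a⇓ b⇓ bal }) (ae-Reaches 1)
    middleElt .range n z d = let _ , _ , _ , _ , _ , _ , (z∈L , _) , _ = middle-sound d in z∈L

    a≺middle : a ≺C middleElt
    a≺middle = ae-map (λ { n _ (z , d) →
      let _ , _ , x , _ , a⇓ , _ , (_ , x<z , _) , _ = middle-sound d in x , z , a⇓ , d , x<z }) (domC middleElt)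

    middle≺b : middleElt ≺C b
    middle≺b = ae-map (λ { n _ (z , d) →
      let _ , _ , _ , y , _ , b⇓ , (_ , _ , z<y) , _ = middle-sound d in z , y , d , b⇓ , z<y }) (domC middleElt)

    ae-sides : ∀ k → C ⊆* (λ n → Many A middle k n × Many middle B k n)
    ae-sides k = ae-map (λ { n _ ((s , s⇓ , large) , (z , d)) →
        sides s⇓ d (stageCount-sound A B s n large) (middle-sound d) })
      -- With 2 + 2k elements seen, removing the slack of 2 and halving leaves k on each side.
      (ae-∧ (ae-Reaches (suc (suc (k + k)))) (domC middleElt))
      where
      sides : ∀ {n s z} → stage ⟨ n ⟩⇓ s → middle ⟨ n ⟩⇓ z →
              Related (λ x y → suc (suc (k + k)) ≤ count s x y) A B n →
              (∃ λ s → stage ⟨ n ⟩⇓ s × Related (λ x y → Balanced s x y z) A B n) →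
              Many A middle k n × Many middle B k n
      sides {s = s} {z} s⇓ d (x , y , a⇓ , b⇓ , large) (_ , s⇓′ , _ , _ , a⇓′ , b⇓′ , _ , le , le′)
        with refl ← ⇓-deterministic s⇓ s⇓′ | refl ← ⇓-deterministic a⇓ a⇓′ | refl ← ⇓-deterministic b⇓ b⇓′ =
          (x , z , a⇓ , d , s , double-cancel-≤ (s≤s⁻¹ (s≤s⁻¹ (≤-trans large le))))
        , (z , y , d , b⇓ , s , double-cancel-≤ (s≤s⁻¹ (s≤s⁻¹ (≤-trans large le′))))

    unbounded-left : Unbounded A middle
    unbounded-left k = ae-map (λ _ _ → proj₁) (ae-sides k)

    unbounded-right : Unbounded middle B
    unbounded-right k = ae-map (λ _ _ → proj₂) (ae-sides k)

-- Density of the finite condensation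

theorem3p9 : (𝓛 : CompLinOrder) (C : ℕ → Set) → CoCE C → Cohesive C →
    CohesivePower.CondensationDense 𝓛 C
theorem3p9 𝓛 C coce coh a b a<b =
  middleElt
  , infinite⇒BlockLt a middleElt a≺middle (unbounded⇒infinite a middleElt unbounded-left)
  , infinite⇒BlockLt middleElt b middle≺b (unbounded⇒infinite middleElt b unbounded-right)
  where
  open Power 𝓛 C coce coh
  open Middle a b (infinite⇒unbounded a b (BlockLt⇒≺ a b a<b) (BlockLt⇒infinite a b a<b))
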